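{- For every primitive-recursive step function $f$ and every $n\in\mathbb N$, $\emptyset\vdash(\mathrm{rrep}(f)\cdot\underline n)\,\mathsf B$ is derivable in OGA.
   Context: **Syntax.** Terms: $t::=v_i\mid\bot\mid\mathbf 0\mid\mathbf S t\mid t=t\mid\neg t\mid t\lor t\mid\lambda t\mid t\cdot t\mid\mathcal R\mid\mathcal A$ ($v_i$, $i\in\mathbb N$, de Bruijn variables; $\lambda$ is the only binder; application associates to the left). A term is well-formed (wf) if generated by this grammar. $\bot$ is a divergent constant, $\mathcal R$ the primitive recursor, $\mathcal A$ the universal quantifier. Abbreviations: $t\,\mathsf N$ is $t=t$; $t\,\mathsf B$ is $t\lor\neg t$; $t\ne u$ is $\neg(t=u)$; $t\land u$ is $\neg(\neg t\lor\neg u)$; $t\to u$ is $\neg t\lor u$; $\underline n=\mathbf S^n\mathbf 0$. $\uparrow$ shifts all free indices up by one; $b[t]$ is the $\beta$-instance substituting $t$ for the outermost bound variable of $b$; $[v\mapsto s]$ is capture-avoiding substitution for a free variable; $\mathrm{fv}$ is the set of free variables. **Head steps** $\triangleright$: $(\lambda b)\cdot t\triangleright b[t]$; $\mathcal R\cdot g\cdot h\cdot\mathbf 0\triangleright g$; $\mathcal R\cdot g\cdot h\cdot(\mathbf S\underline n)\triangleright h\cdot\underline n\cdot(\mathcal R\cdot g\cdot h\cdot\underline n)$; if $t\triangleright t'$ then $t\cdot u\triangleright t'\cdot u$. **Rules.** Judgments are $\Gamma\vdash c$, $\Gamma$ a finite set of wf terms, $c$ a wf term (all terms in rules are wf). A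 proof is a finite list of judgments each following from earlier entries by one rule; $\Gamma\vdash c$ is derivable if it occurs in a proof. Rules ("$\Rightarrow$" from premises to conclusion, "$\Leftrightarrow$" both directions; $\Gamma$ is the context of a judgment when none is shown): $\Gamma,c\vdash c$; $\Gamma\vdash c\Rightarrow\Gamma,a\vdash c$; $\Gamma\vdash a$ and $\Gamma,a\vdash c\Rightarrow\Gamma\vdash c$; $\Gamma\vdash c\Rightarrow[v\mapsto s]\Gamma\vdash[v\mapsto s]c$; $\vdash a\Leftrightarrow\ \vdash a=\underline1$; $\vdash\neg a\Leftrightarrow\ \vdash a=\underline0$; $\vdash\neg a,\ \vdash a\Rightarrow\ \vdash c$; $\vdash a\Leftrightarrow\ \vdash\neg\neg a$; $\vdash a\Rightarrow\ \vdash a\lor b$; $\vdash b\Rightarrow\ \vdash a\lor b$; $\vdash\neg a,\ \vdash\neg b\Rightarrow\ \vdash\neg(a\lor b)$; $\vdash a\lor b,\ \Gamma,a\vdash c,\ \Gamma,b\vdash c\Rightarrow\ \vdash c$; $\vdash\neg(a\lor b)\Rightarrow\ \vdash\neg a$; $\vdash\neg(a\lor b)\Rightarrow\ \vdash\neg b$; $\vdash a\,\mathsf N\Leftrightarrow\ \vdash a=a$; $\vdash a=b\Rightarrow\ \vdash b=a$; $\vdash a=b,\ \vdash[v\mapsto a]p\Rightarrow\ \vdash[v\mapsto b]p$; $\vdash a\ne b\Rightarrow\ \vdash b\ne a$; $\vdash a\,\mathsf N,\ \vdash b\,\mathsf N\Rightarrow\ \vdash(a=b)\,\mathsf B$; $\vdash(a=b)\,\mathsf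 B\Rightarrow\ \vdash(a\,\mathsf N)\land(b\,\mathsf N)$; $\vdash\mathbf 0\,\mathsf N$; $\vdash a\,\mathsf N\Leftrightarrow\ \vdash(\mathbf S a)\,\mathsf N$; $\vdash a\,\mathsf N\Rightarrow\ \vdash\mathbf S a\ne\mathbf 0$; $\vdash a\ne b\Leftrightarrow\ \vdash\mathbf S a\ne\mathbf S b$; $\vdash\mathbf S a=\mathbf S b\Rightarrow\ \vdash a=b$; $\vdash\bot\,\mathsf N\Rightarrow\ \vdash p$; induction: $\vdash[v_i\mapsto\mathbf 0]c$, $\ v_i\,\mathsf N,c,\Gamma\vdash[v_i\mapsto\mathbf S v_i]c$, $\ \vdash a\,\mathsf N\Rightarrow\ \vdash[v_i\mapsto a]c$ if $v_i\notin\mathrm{fv}(\Gamma)$; conversion, for $c\triangleright c'$: $\vdash c'\Rightarrow\ \vdash c$; $\vdash c\Rightarrow\ \vdash c'$; $\vdash\neg c\Rightarrow\ \vdash\neg c'$; $\vdash c'\,\mathsf N\Rightarrow\ \vdash c=c'$; $\vdash m\,\mathsf N,\ \vdash(h\cdot m\cdot(\mathcal R\cdot g\cdot h\cdot m))\,\mathsf N\Rightarrow\ \vdash\mathcal R\cdot g\cdot h\cdot(\mathbf S m)=h\cdot m\cdot(\mathcal R\cdot g\cdot h\cdot m)$; $v_0\,\mathsf N,\uparrow\Gamma\vdash\uparrow f\cdot v_0\Rightarrow\Gamma\vdash\mathcal A\cdot f$; $\vdash\mathcal A\cdot f,\ \vdash a\,\mathsf N\Rightarrow\ \vdash f\cdot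 a$; $\vdash\neg(f\cdot a),\ \vdash a\,\mathsf N\Rightarrow\ \vdash\neg(\mathcal A\cdot f)$; $\Gamma\vdash\neg(\mathcal A\cdot f)$ and $v_0\,\mathsf N,\neg(\uparrow f\cdot v_0),\uparrow\Gamma\vdash\uparrow c\Rightarrow\Gamma\vdash c$. These are the rules of RGA. OGA has these and the rule ATI: $\Gamma\vdash\mathcal A\cdot(\lambda((\uparrow u\cdot v_0)\,\mathsf B))\Rightarrow\Gamma\vdash(\mathcal A\cdot u)\,\mathsf B$. **Search sentences.** A step function is a primitive recursive $f:\mathbb N^2\to\mathbb N$ presented by a primitive recursive definition (from zero, successor, projections by composition and primitive recursion). Its search at $n$ hits at step $k$ if $f(n,k)\neq0$, and hits if it hits at some step. $\mathrm{cmp}(f)$ is the closed term obtained by compiling the definition into curried $\lambda$-terms: zero functions to $\lambda\cdots\lambda\,\mathbf 0$, successor to $\lambda\,\mathbf S v_0$, projections to $\lambda\cdots\lambda\,v_i$, composition to the corresponding applications, and $F(0,\vec x)=G(\vec x)$, $F(m+1,\vec x)=H(m,F(m,\vec x),\vec x)$ to the curried term sending $y,\vec x$ to $\mathcal R\cdot(\mathrm{cmp}(G)\cdot\vec x)\cdot(\lambda\lambda\,\mathrm{cmp}(H)\cdot v_1\cdot v_0\cdot\vec x)\cdot y$ (indices of $\vec x$ shifted under the $\lambda$s). Put $\mathrm{rmat}(f,n)=\lambda(\mathrm{cmp}(f)\cdot\underline n\cdot v_0=\mathbf 0)$ and $\mathrm{rrep}(f)=\lambda\,\neg(\mathcal A\cdot\lambda(\mathrm{cmp}(f)\cdot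 v_1\cdot v_0=\mathbf 0))$. So $\mathrm{rrep}(f)\cdot\underline n\triangleright\neg(\mathcal A\cdot\mathrm{rmat}(f,n))$ expresses that the search of $f$ at $n$ hits. -}

module Defs where

open import Data.Nat using (ℕ; zero; suc; _+_; _≟_)
open import Data.Fin using (Fin)
open import Data.List using (List; []; _∷_; map)
open import Data.List.Membership.Propositional using (_∈_)
open import Data.List.Relation.Binary.BagAndSetEquality using (_∼[_]_; set)
open import Data.List.Relation.Unary.All using (All)
open import Data.List.Relation.Unary.Any using (Any)
open import Data.Vec as Vec using (Vec; []; _∷_)
open import Data.Empty using (⊥)
open import Data.Product using (∃-syntax; _×_)
open import Data.Sum using (_⊎_)
open import Relation.Binary.PropositionalEquality using (_≡_)
open import Relation.Nullary using (¬_; yes; no)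

infixl 9 _·_
infix  8 _𝖭 _𝖡
infix  7 _≐_ _≠_
infix  7 ∼_
infixr 6 _∨_ _∧_
infix  5 ƛ_

data Term : Set where
  var : ℕ → Term
  bot : Term
  𝟎   : Term
  𝐒   : Term → Term
  _≐_ : Term → Term → Term
  ∼_  : Term → Term
  _∨_ : Term → Term → Term
  ƛ_  : Term → Term
  _·_ : Term → Term → Term
  𝓡   : Term
  𝓐   : Term

_𝖭 _𝖡 : Term → Term
t 𝖭 = t ≐ t
t 𝖡 = t ∨ (∼ t)

_≠_ _∧_ : Term → Term → Term
t ≠ u = ∼ (t ≐ u)
t ∧ u = ∼ ((∼ t) ∨ (∼ u))

num : ℕ → Term
num zero    = 𝟎
num (suc n) = 𝐒 (num n)

liftRen : (ℕ → ℕ) → ℕ → ℕ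
liftRen ρ zero    = zero
liftRen ρ (suc i) = suc (ρ i)

rename : (ℕ → ℕ) → Term → Term
rename ρ (var i) = var (ρ i)
rename ρ bot     = bot
rename ρ 𝟎       = 𝟎
rename ρ (𝐒 t)   = 𝐒 (rename ρ t)
rename ρ (t ≐ u) = rename ρ t ≐ rename ρ u
rename ρ (∼ t)   = ∼ rename ρ t
rename ρ (t ∨ u) = rename ρ t ∨ rename ρ u
rename ρ (ƛ t)   = ƛ rename (liftRen ρ) t
rename ρ (t · u) = rename ρ t · rename ρ u
rename ρ 𝓡       = 𝓡
rename ρ 𝓐       = 𝓐

↑ : Term → Term
↑ = rename suc

liftSub : (ℕ → Term) → ℕ → Term
liftSub σ zero    = var zero
liftSub σ (suc i) = ↑ (σ i)

subst : (ℕ → Term) → Term → Term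
subst σ (var i) = σ i
subst σ bot     = bot
subst σ 𝟎       = 𝟎
subst σ (𝐒 t)   = 𝐒 (subst σ t)
subst σ (t ≐ u) = subst σ t ≐ subst σ u
subst σ (∼ t)   = ∼ subst σ t
subst σ (t ∨ u) = subst σ t ∨ subst σ u
subst σ (ƛ t)   = ƛ subst (liftSub σ) t
subst σ (t · u) = subst σ t · subst σ u
subst σ 𝓡       = 𝓡
subst σ 𝓐       = 𝓐

β-sub : Term → ℕ → Term
β-sub t zero    = t
β-sub t (suc i) = var i

_[_] : Term → Term → Term
b [ t ] = subst (β-sub t) b

-- Unlike b [ t ], the substitution [ i ↦ s ] leaves every other free variable
-- unchanged: indices above i are not decremented.
single : ℕ → Term → ℕ → Term
single i s j with i ≟ j
... | yes _ = s
... | no  _ = var j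

[_↦_]_ : ℕ → Term → Term → Term
[ i ↦ s ] t = subst (single i s) t

_∈fv_ : ℕ → Term → Set
i ∈fv var j   = i ≡ j
i ∈fv bot     = ⊥
i ∈fv 𝟎       = ⊥
i ∈fv 𝐒 t     = i ∈fv t
i ∈fv (t ≐ u) = i ∈fv t ⊎ i ∈fv u
i ∈fv (∼ t)   = i ∈fv t
i ∈fv (t ∨ u) = i ∈fv t ⊎ i ∈fv u
i ∈fv (ƛ t)   = suc i ∈fv t
i ∈fv (t · u) = i ∈fv t ⊎ i ∈fv u
i ∈fv 𝓡       = ⊥
i ∈fv 𝓐       = ⊥

infix 4 _▷_

data _▷_ : Term → Term → Set where
  β    : ∀ {b t} → (ƛ b) · t ▷ b [ t ]
  rec0 : ∀ {g h} → 𝓡 · g · h · 𝟎 ▷ g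
  recS : ∀ {g h} n →
         𝓡 · g · h · 𝐒 (num n) ▷ h · num n · (𝓡 · g · h · num n)
  appˡ : ∀ {t t′ u} → t ▷ t′ → t · u ▷ t′ · u

-- Lists stand for finite sets of terms; the rule ctx-set below identifies
-- lists that have the same elements.
Context : Set
Context = List Term

infix 3 _⊢_

data Judgment : Set where
  _⊢_ : Context → Term → Judgment

infix 2 _⟹ᴿ_ _⟹ᴼ_

-- ps ⟹ᴿ j: j follows from the premises ps by one application of a rule of RGA.
data _⟹ᴿ_ : List Judgment → Judgment → Set where
  ctx-set : ∀ {Γ Δ c} → Γ ∼[ set ] Δ →
            (Γ ⊢ c) ∷ [] ⟹ᴿ Δ ⊢ c

  hyp     : ∀ {Γ c} → [] ⟹ᴿ c ∷ Γ ⊢ c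
  weaken  : ∀ {Γ a c} → (Γ ⊢ c) ∷ [] ⟹ᴿ a ∷ Γ ⊢ c
  cut     : ∀ {Γ a c} → (Γ ⊢ a) ∷ (a ∷ Γ ⊢ c) ∷ [] ⟹ᴿ Γ ⊢ c
  inst    : ∀ {Γ c} i s →
            (Γ ⊢ c) ∷ [] ⟹ᴿ map ([ i ↦ s ]_) Γ ⊢ [ i ↦ s ] c

  true-I  : ∀ {Γ a} → (Γ ⊢ a) ∷ [] ⟹ᴿ Γ ⊢ a ≐ num 1
  true-E  : ∀ {Γ a} → (Γ ⊢ a ≐ num 1) ∷ [] ⟹ᴿ Γ ⊢ a
  false-I : ∀ {Γ a} → (Γ ⊢ ∼ a) ∷ [] ⟹ᴿ Γ ⊢ a ≐ num 0
  false-E : ∀ {Γ a} → (Γ ⊢ a ≐ num 0) ∷ [] ⟹ᴿ Γ ⊢ ∼ a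

  ∼-E     : ∀ {Γ a c} → (Γ ⊢ ∼ a) ∷ (Γ ⊢ a) ∷ [] ⟹ᴿ Γ ⊢ c
  ∼∼-I    : ∀ {Γ a} → (Γ ⊢ a) ∷ [] ⟹ᴿ Γ ⊢ ∼ (∼ a)
  ∼∼-E    : ∀ {Γ a} → (Γ ⊢ ∼ (∼ a)) ∷ [] ⟹ᴿ Γ ⊢ a

  ∨-I₁    : ∀ {Γ a b} → (Γ ⊢ a) ∷ [] ⟹ᴿ Γ ⊢ a ∨ b
  ∨-I₂    : ∀ {Γ a b} → (Γ ⊢ b) ∷ [] ⟹ᴿ Γ ⊢ a ∨ b
  ∼∨-I    : ∀ {Γ a b} → (Γ ⊢ ∼ a) ∷ (Γ ⊢ ∼ b) ∷ [] ⟹ᴿ Γ ⊢ ∼ (a ∨ b)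
  ∨-E     : ∀ {Γ a b c} →
            (Γ ⊢ a ∨ b) ∷ (a ∷ Γ ⊢ c) ∷ (b ∷ Γ ⊢ c) ∷ [] ⟹ᴿ Γ ⊢ c
  ∼∨-E₁   : ∀ {Γ a b} → (Γ ⊢ ∼ (a ∨ b)) ∷ [] ⟹ᴿ Γ ⊢ ∼ a
  ∼∨-E₂   : ∀ {Γ a b} → (Γ ⊢ ∼ (a ∨ b)) ∷ [] ⟹ᴿ Γ ⊢ ∼ b

  𝖭⇒≐     : ∀ {Γ a} → (Γ ⊢ a 𝖭) ∷ [] ⟹ᴿ Γ ⊢ a ≐ a
  ≐⇒𝖭     : ∀ {Γ a} → (Γ ⊢ a ≐ a) ∷ [] ⟹ᴿ Γ ⊢ a 𝖭
  ≐-sym   : ∀ {Γ a b} → (Γ ⊢ a ≐ b) ∷ [] ⟹ᴿ Γ ⊢ b ≐ a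
  ≐-subst : ∀ {Γ a b} i p →
            (Γ ⊢ a ≐ b) ∷ (Γ ⊢ [ i ↦ a ] p) ∷ [] ⟹ᴿ Γ ⊢ [ i ↦ b ] p
  ≠-sym   : ∀ {Γ a b} → (Γ ⊢ a ≠ b) ∷ [] ⟹ᴿ Γ ⊢ b ≠ a
  ≐-𝖡     : ∀ {Γ a b} → (Γ ⊢ a 𝖭) ∷ (Γ ⊢ b 𝖭) ∷ [] ⟹ᴿ Γ ⊢ (a ≐ b) 𝖡
  ≐-𝖡-E   : ∀ {Γ a b} → (Γ ⊢ (a ≐ b) 𝖡) ∷ [] ⟹ᴿ Γ ⊢ (a 𝖭) ∧ (b 𝖭)

  𝟎-𝖭     : ∀ {Γ} → [] ⟹ᴿ Γ ⊢ 𝟎 𝖭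
  𝐒-𝖭     : ∀ {Γ a} → (Γ ⊢ a 𝖭) ∷ [] ⟹ᴿ Γ ⊢ (𝐒 a) 𝖭
  𝐒-𝖭-E   : ∀ {Γ a} → (Γ ⊢ (𝐒 a) 𝖭) ∷ [] ⟹ᴿ Γ ⊢ a 𝖭
  𝐒≠𝟎     : ∀ {Γ a} → (Γ ⊢ a 𝖭) ∷ [] ⟹ᴿ Γ ⊢ 𝐒 a ≠ 𝟎
  𝐒-≠     : ∀ {Γ a b} → (Γ ⊢ a ≠ b) ∷ [] ⟹ᴿ Γ ⊢ 𝐒 a ≠ 𝐒 b
  𝐒-≠-E   : ∀ {Γ a b} → (Γ ⊢ 𝐒 a ≠ 𝐒 b) ∷ [] ⟹ᴿ Γ ⊢ a ≠ b
  𝐒-≐-E   : ∀ {Γ a b} → (Γ ⊢ 𝐒 a ≐ 𝐒 b) ∷ [] ⟹ᴿ Γ ⊢ a ≐ b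
  bot-E   : ∀ {Γ p} → (Γ ⊢ bot 𝖭) ∷ [] ⟹ᴿ Γ ⊢ p

  ind     : ∀ {Γ a} i c → ¬ Any (i ∈fv_) Γ →
            (Γ ⊢ [ i ↦ 𝟎 ] c)
            ∷ (var i 𝖭 ∷ c ∷ Γ ⊢ [ i ↦ 𝐒 (var i) ] c)
            ∷ (Γ ⊢ a 𝖭)
            ∷ [] ⟹ᴿ Γ ⊢ [ i ↦ a ] c

  ▷-exp   : ∀ {Γ c c′} → c ▷ c′ → (Γ ⊢ c′) ∷ [] ⟹ᴿ Γ ⊢ c
  ▷-red   : ∀ {Γ c c′} → c ▷ c′ → (Γ ⊢ c) ∷ [] ⟹ᴿ Γ ⊢ c′
  ▷-∼     : ∀ {Γ c c′} → c ▷ c′ → (Γ ⊢ ∼ c) ∷ [] ⟹ᴿ Γ ⊢ ∼ c′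
  ▷-≐     : ∀ {Γ c c′} → c ▷ c′ → (Γ ⊢ c′ 𝖭) ∷ [] ⟹ᴿ Γ ⊢ c ≐ c′

  𝓡-𝐒     : ∀ {Γ g h m} →
            (Γ ⊢ m 𝖭) ∷ (Γ ⊢ (h · m · (𝓡 · g · h · m)) 𝖭) ∷ []
            ⟹ᴿ Γ ⊢ 𝓡 · g · h · 𝐒 m ≐ h · m · (𝓡 · g · h · m)

  𝓐-I     : ∀ {Γ f} →
            (var 0 𝖭 ∷ map ↑ Γ ⊢ ↑ f · var 0) ∷ [] ⟹ᴿ Γ ⊢ 𝓐 · f
  𝓐-E     : ∀ {Γ f a} → (Γ ⊢ 𝓐 · f) ∷ (Γ ⊢ a 𝖭) ∷ [] ⟹ᴿ Γ ⊢ f · a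
  ∼𝓐-I    : ∀ {Γ f a} →
            (Γ ⊢ ∼ (f · a)) ∷ (Γ ⊢ a 𝖭) ∷ [] ⟹ᴿ Γ ⊢ ∼ (𝓐 · f)
  ∼𝓐-E    : ∀ {Γ f c} →
            (Γ ⊢ ∼ (𝓐 · f))
            ∷ (var 0 𝖭 ∷ ∼ (↑ f · var 0) ∷ map ↑ Γ ⊢ ↑ c)
            ∷ [] ⟹ᴿ Γ ⊢ c

data _⟹ᴼ_ : List Judgment → Judgment → Set where
  rga : ∀ {ps j} → ps ⟹ᴿ j → ps ⟹ᴼ j
  ATI : ∀ {Γ u} →
        (Γ ⊢ 𝓐 · (ƛ ((↑ u · var 0) 𝖡))) ∷ [] ⟹ᴼ Γ ⊢ (𝓐 · u) 𝖡

-- A proof lists its judgments with the most recent one first.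
data Proof (_⟹_ : List Judgment → Judgment → Set) : List Judgment → Set where
  []   : Proof _⟹_ []
  step : ∀ {js ps j} →
         Proof _⟹_ js → All (_∈ js) ps → ps ⟹ j → Proof _⟹_ (j ∷ js)

Derivable : (List Judgment → Judgment → Set) → Judgment → Set
Derivable _⟹_ j = ∃[ js ] (Proof _⟹_ js × j ∈ js)

OGA-derivable : Judgment → Set
OGA-derivable = Derivable _⟹ᴼ_

data PR : ℕ → Set where
  zer  : ∀ {n} → PR n
  succ : PR 1
  proj : ∀ {n} → Fin n → PR n
  comp : ∀ {m n} → PR m → Vec (PR n) m → PR n
  prec : ∀ {n} → PR n → PR (suc (suc n)) → PR (suc n)

-- The function presented by a definition.  The compilation cmp does not use
-- it; it fixes the argument order of comp and prec.
mutual
  ⟦_⟧ : ∀ {n} → PR n → Vec ℕ n → ℕ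
  ⟦ zer ⟧       xs            = 0
  ⟦ succ ⟧      (x ∷ [])      = suc x
  ⟦ proj i ⟧    xs            = Vec.lookup xs i
  ⟦ comp g hs ⟧ xs            = ⟦ g ⟧ (⟦ hs ⟧* xs)
  ⟦ prec g h ⟧  (zero ∷ xs)   = ⟦ g ⟧ xs
  ⟦ prec g h ⟧  (suc y ∷ xs)  = ⟦ h ⟧ (y ∷ ⟦ prec g h ⟧ (y ∷ xs) ∷ xs)

  ⟦_⟧* : ∀ {m n} → Vec (PR n) m → Vec ℕ n → Vec ℕ m
  ⟦ [] ⟧*     xs = []
  ⟦ h ∷ hs ⟧* xs = ⟦ h ⟧ xs ∷ ⟦ hs ⟧* xs

lams : ℕ → Term → Term
lams zero    t = t
lams (suc n) t = ƛ lams n t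

apps : ∀ {m} → Term → Vec Term m → Term
apps t []       = t
apps t (u ∷ us) = apps (t · u) us

-- The arguments of an n-fold abstraction, first argument first, seen from
-- under d further binders: v_{n-1+d}, …, v_d.
args : (n d : ℕ) → Vec Term n
args zero    d = []
args (suc n) d = var (n + d) ∷ args n d

-- Compiled terms are closed, so they are placed under binders unshifted.
mutual
  cmp : ∀ {n} → PR n → Term
  cmp {n} zer                = lams n 𝟎
  cmp succ                   = ƛ 𝐒 (var 0)
  cmp {n} (proj i)           = lams n (Vec.lookup (args n 0) i)
  cmp {n} (comp g hs)        = lams n (apps (cmp g) (cmp* hs (args n 0)))
  cmp {suc n} (prec g h)     =
    lams (suc n)
      (𝓡 · apps (cmp g) (args n 0)
         · (ƛ ƛ apps (cmp h · var 1 · var 0) (args n 2))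
         · var n)

  cmp* : ∀ {m n} → Vec (PR n) m → Vec Term n → Vec Term m
  cmp* []       xs = []
  cmp* (h ∷ hs) xs = apps (cmp h) xs ∷ cmp* hs xs

StepFunction : Set
StepFunction = PR 2

rrep : StepFunction → Term
rrep f = ƛ ∼ (𝓐 · (ƛ (cmp f · var 1 · var 0 ≐ 𝟎)))

{-# OPTIONS --safe #-}
module Submission where

-- Every compiled primitive recursive function is provably total: applied to
-- arguments that provably satisfy 𝖭, it satisfies 𝖭 again.  This goes by
-- induction on the definition, and the recursor case by the object-level
-- induction rule, with 𝓡-𝐒 for the step.  Hence the equation
-- cmp f · num n · v₀ = 𝟎 is provably boolean for v₀ 𝖭, ATI makes its universal
-- closure boolean, and 𝖡 is inherited by negations and by head expansions.

open import Data.Nat using (ℕ; zero; suc; _+_; _<_; _≟_; _⊔_)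
open import Data.Nat.Properties
  using (≤-refl; <-trans; <-irrefl; n<1+n; m<n⇒m<n⊔o; m<n⇒m<o⊔n; +-suc; +-identityʳ; +-comm)
open import Data.List using (List; []; _∷_; _++_; map)
open import Data.List.Membership.Propositional using (_∈_)
open import Data.List.Membership.Propositional.Properties using (∈-++⁺ˡ; ∈-++⁺ʳ)
open import Data.List.Relation.Unary.All as All using (All; []; _∷_)
open import Data.List.Relation.Unary.Any using (Any; here; there)
open import Data.Vec as Vec using (Vec; []; _∷_)
open import Data.Vec.Properties using (lookup-map)
open import Data.Vec.Relation.Unary.All as VecAll using ([]; _∷_)
open import Data.Vec.Relation.Unary.All.Properties using (lookup⁺)
open import Data.Product using (∃-syntax; _×_; _,_)
open import Data.Sum using (inj₁; inj₂)
open import Function using (_∘_)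
open import Relation.Binary.Construct.Closure.ReflexiveTransitive using (Star; ε; _◅_)
open import Relation.Binary.PropositionalEquality
  using (_≡_; _≢_; refl; sym; trans; cong; cong₂) renaming (subst to transport)
open import Relation.Nullary using (¬_; yes; no; contradiction)
open import Defs

-- Substitution calculus

-- The composite is any `ρ″` that agrees pointwise, so under `ƛ` only the lifted maps are compared,
-- index by index. The other fusion laws take the same form.
rename-rename : ∀ {ρ ρ′ ρ″} → (∀ i → ρ′ (ρ i) ≡ ρ″ i) →
                ∀ t → rename ρ′ (rename ρ t) ≡ rename ρ″ t
rename-rename e (var i) = cong var (e i)
rename-rename e bot     = refl
rename-rename e 𝟎       = refl
rename-rename e (𝐒 t)   = cong 𝐒 (rename-rename e t)
rename-rename e (t ≐ u) = cong₂ _≐_ (rename-rename e t) (rename-rename e u)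
rename-rename e (∼ t)   = cong ∼_ (rename-rename e t)
rename-rename e (t ∨ u) = cong₂ _∨_ (rename-rename e t) (rename-rename e u)
rename-rename e (ƛ t)   = cong ƛ_ (rename-rename (λ { zero → refl ; (suc i) → cong suc (e i) }) t)
rename-rename e (t · u) = cong₂ _·_ (rename-rename e t) (rename-rename e u)
rename-rename e 𝓡       = refl
rename-rename e 𝓐       = refl

subst-rename : ∀ {ρ σ τ} → (∀ i → σ (ρ i) ≡ τ i) →
               ∀ t → subst σ (rename ρ t) ≡ subst τ t
subst-rename e (var i) = e i
subst-rename e bot     = refl
subst-rename e 𝟎       = refl
subst-rename e (𝐒 t)   = cong 𝐒 (subst-rename e t)
subst-rename e (t ≐ u) = cong₂ _≐_ (subst-rename e t) (subst-rename e u)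
subst-rename e (∼ t)   = cong ∼_ (subst-rename e t)
subst-rename e (t ∨ u) = cong₂ _∨_ (subst-rename e t) (subst-rename e u)
subst-rename e (ƛ t)   = cong ƛ_ (subst-rename (λ { zero → refl ; (suc i) → cong ↑ (e i) }) t)
subst-rename e (t · u) = cong₂ _·_ (subst-rename e t) (subst-rename e u)
subst-rename e 𝓡       = refl
subst-rename e 𝓐       = refl

rename-↑ : ∀ ρ t → rename (liftRen ρ) (↑ t) ≡ ↑ (rename ρ t)
rename-↑ ρ t = trans (rename-rename (λ _ → refl) t) (sym (rename-rename (λ _ → refl) t))

rename-subst : ∀ {ρ σ τ} → (∀ i → rename ρ (σ i) ≡ τ i) →
               ∀ t → rename ρ (subst σ t) ≡ subst τ t
rename-subst e (var i) = e i
rename-subst e bot     = refl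
rename-subst e 𝟎       = refl
rename-subst e (𝐒 t)   = cong 𝐒 (rename-subst e t)
rename-subst e (t ≐ u) = cong₂ _≐_ (rename-subst e t) (rename-subst e u)
rename-subst e (∼ t)   = cong ∼_ (rename-subst e t)
rename-subst e (t ∨ u) = cong₂ _∨_ (rename-subst e t) (rename-subst e u)
rename-subst {ρ} {σ} e (ƛ t) = cong ƛ_
  (rename-subst (λ { zero → refl ; (suc i) → trans (rename-↑ ρ (σ i)) (cong ↑ (e i)) }) t)
rename-subst e (t · u) = cong₂ _·_ (rename-subst e t) (rename-subst e u)
rename-subst e 𝓡       = refl
rename-subst e 𝓐       = refl

subst-↑ : ∀ σ t → subst (liftSub σ) (↑ t) ≡ ↑ (subst σ t)
subst-↑ σ t = trans (subst-rename (λ _ → refl) t) (sym (rename-subst (λ _ → refl) t))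

subst-subst : ∀ {σ σ′ τ} → (∀ i → subst σ′ (σ i) ≡ τ i) →
              ∀ t → subst σ′ (subst σ t) ≡ subst τ t
subst-subst e (var i) = e i
subst-subst e bot     = refl
subst-subst e 𝟎       = refl
subst-subst e (𝐒 t)   = cong 𝐒 (subst-subst e t)
subst-subst e (t ≐ u) = cong₂ _≐_ (subst-subst e t) (subst-subst e u)
subst-subst e (∼ t)   = cong ∼_ (subst-subst e t)
subst-subst e (t ∨ u) = cong₂ _∨_ (subst-subst e t) (subst-subst e u)
subst-subst {σ} {σ′} e (ƛ t) = cong ƛ_
  (subst-subst (λ { zero → refl ; (suc i) → trans (subst-↑ σ′ (σ i)) (cong ↑ (e i)) }) t)
subst-subst e (t · u) = cong₂ _·_ (subst-subst e t) (subst-subst e u)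
subst-subst e 𝓡       = refl
subst-subst e 𝓐       = refl

subst-cong : ∀ {σ τ} t → (∀ i → i ∈fv t → σ i ≡ τ i) → subst σ t ≡ subst τ t
subst-cong (var i) e = e i refl
subst-cong bot     e = refl
subst-cong 𝟎       e = refl
subst-cong (𝐒 t)   e = cong 𝐒 (subst-cong t e)
subst-cong (t ≐ u) e = cong₂ _≐_ (subst-cong t (λ i → e i ∘ inj₁)) (subst-cong u (λ i → e i ∘ inj₂))
subst-cong (∼ t)   e = cong ∼_ (subst-cong t e)
subst-cong (t ∨ u) e = cong₂ _∨_ (subst-cong t (λ i → e i ∘ inj₁)) (subst-cong u (λ i → e i ∘ inj₂))
subst-cong (ƛ t)   e = cong ƛ_
  (subst-cong t (λ { zero _ → refl ; (suc i) i∈ → cong ↑ (e i i∈) }))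
subst-cong (t · u) e = cong₂ _·_ (subst-cong t (λ i → e i ∘ inj₁)) (subst-cong u (λ i → e i ∘ inj₂))
subst-cong 𝓡       e = refl
subst-cong 𝓐       e = refl

subst-id : ∀ {σ} → (∀ i → σ i ≡ var i) → ∀ t → subst σ t ≡ t
subst-id e (var i) = e i
subst-id e bot     = refl
subst-id e 𝟎       = refl
subst-id e (𝐒 t)   = cong 𝐒 (subst-id e t)
subst-id e (t ≐ u) = cong₂ _≐_ (subst-id e t) (subst-id e u)
subst-id e (∼ t)   = cong ∼_ (subst-id e t)
subst-id e (t ∨ u) = cong₂ _∨_ (subst-id e t) (subst-id e u)
subst-id e (ƛ t)   = cong ƛ_ (subst-id (λ { zero → refl ; (suc i) → cong ↑ (e i) }) t)
subst-id e (t · u) = cong₂ _·_ (subst-id e t) (subst-id e u)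
subst-id e 𝓡       = refl
subst-id e 𝓐       = refl

↑-[] : ∀ t a → (↑ t) [ a ] ≡ t
↑-[] t a = trans (subst-rename (λ _ → refl) t) (subst-id (λ _ → refl) t)

infixr 5 _•_

_•_ : Term → (ℕ → Term) → ℕ → Term
(t • σ) zero    = t
(t • σ) (suc i) = σ i

-- A β-step under a pending substitution just extends that substitution by the argument; iterating
-- this yields `env`.
lift-[] : ∀ σ t b → subst (liftSub σ) b [ t ] ≡ subst (t • σ) b
lift-[] σ t = subst-subst
  (λ { zero → refl ; (suc i) → ↑-[] (σ i) t })

-- The premises of `𝓐-I` and `ATI` contain `↑ f · var 0`. When `f` is an abstraction, the shift and
-- the instance at `var 0` cancel.
↑ƛ-▷ : ∀ b → ↑ (ƛ b) · var 0 ▷ b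
↑ƛ-▷ b = transport (↑ (ƛ b) · var 0 ▷_)
  (trans (subst-rename {τ = var} (λ { zero → refl ; (suc i) → refl }) b)
         (subst-id (λ _ → refl) b))
  β

-- Fresh variables

fv-bound : Term → ℕ
fv-bound (var i) = suc i
fv-bound bot     = 0
fv-bound 𝟎       = 0
fv-bound (𝐒 t)   = fv-bound t
fv-bound (t ≐ u) = fv-bound t ⊔ fv-bound u
fv-bound (∼ t)   = fv-bound t
fv-bound (t ∨ u) = fv-bound t ⊔ fv-bound u
-- Not tight: if `suc i` lies below the bound of the body, so does `i`.
fv-bound (ƛ t)   = fv-bound t
fv-bound (t · u) = fv-bound t ⊔ fv-bound u
fv-bound 𝓡       = 0
fv-bound 𝓐       = 0

∈fv⇒< : ∀ {i} t → i ∈fv t → i < fv-bound t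
∈fv⇒< (var j) refl     = ≤-refl
∈fv⇒< (𝐒 t)   p        = ∈fv⇒< t p
∈fv⇒< (t ≐ u) (inj₁ p) = m<n⇒m<n⊔o _ (∈fv⇒< t p)
∈fv⇒< (t ≐ u) (inj₂ p) = m<n⇒m<o⊔n _ (∈fv⇒< u p)
∈fv⇒< (∼ t)   p        = ∈fv⇒< t p
∈fv⇒< (t ∨ u) (inj₁ p) = m<n⇒m<n⊔o _ (∈fv⇒< t p)
∈fv⇒< (t ∨ u) (inj₂ p) = m<n⇒m<o⊔n _ (∈fv⇒< u p)
∈fv⇒< (ƛ t)   p        = <-trans (n<1+n _) (∈fv⇒< t p)
∈fv⇒< (t · u) (inj₁ p) = m<n⇒m<n⊔o _ (∈fv⇒< t p)
∈fv⇒< (t · u) (inj₂ p) = m<n⇒m<o⊔n _ (∈fv⇒< u p)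

fresh : ∀ Γ → ∃[ i ] ¬ Any (i ∈fv_) Γ
fresh Γ = bound Γ , λ p → <-irrefl refl (Any⇒< Γ p)
  where
  bound : Context → ℕ
  bound []      = 0
  bound (t ∷ Γ) = fv-bound t ⊔ bound Γ

  Any⇒< : ∀ {i} Γ → Any (i ∈fv_) Γ → i < bound Γ
  Any⇒< (t ∷ Γ) (here p)  = m<n⇒m<n⊔o _ (∈fv⇒< t p)
  Any⇒< (t ∷ Γ) (there p) = m<n⇒m<o⊔n _ (Any⇒< Γ p)

single-≡ : ∀ i s → single i s i ≡ s
single-≡ i s with i ≟ i
... | yes _  = refl
... | no i≢i = contradiction refl i≢i

single-≢ : ∀ {i j} s → i ≢ j → single i s j ≡ var j
single-≢ {i} {j} s i≢j with i ≟ j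
... | yes i≡j = contradiction i≡j i≢j
... | no _    = refl

-- The rules ≐-subst and ind act on a named variable.  Applied to p [ var i ]
-- with i fresh, they act on the β-instances of p.
↦-[] : ∀ {i} p {a} → ¬ i ∈fv (ƛ p) → [ i ↦ a ] (p [ var i ]) ≡ p [ a ]
↦-[] {i} p {a} i∉ = trans (subst-subst (λ _ → refl) p) (subst-cong p agree)
  where
  agree : ∀ j → j ∈fv p → [ i ↦ a ] (β-sub (var i) j) ≡ β-sub a j
  agree zero    _  = single-≡ i a
  agree (suc j) j∈ = single-≢ a λ { refl → i∉ j∈ }

-- Derived rules

module _ {_⟹_ : List Judgment → Judgment → Set} where

  Proof-++ : ∀ {js ks} → Proof _⟹_ js → Proof _⟹_ ks → Proof _⟹_ (js ++ ks)
  Proof-++ []             q = q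
  Proof-++ (step p ∈js r) q = step (Proof-++ p q) (All.map ∈-++⁺ˡ ∈js) r

  -- A rule wants all its premises in one list, but each derivation brings its own; concatenation
  -- joins them. Through `by`, derivations compose like trees.
  merge : ∀ {ps} → All (Derivable _⟹_) ps → ∃[ js ] (Proof _⟹_ js × All (_∈ js) ps)
  merge []                  = [] , [] , []
  merge ((js , p , j∈) ∷ ds) with merge ds
  ... | ks , q , ∈ks = js ++ ks , Proof-++ p q , ∈-++⁺ˡ j∈ ∷ All.map (∈-++⁺ʳ js) ∈ks

  by : ∀ {ps j} → ps ⟹ j → All (Derivable _⟹_) ps → Derivable _⟹_ j
  by r ds with merge ds
  ... | js , p , ∈js = _ ∷ js , step p ∈js r , here refl

infix 3 _⊩_

_⊩_ : Context → Term → Set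
Γ ⊩ c = OGA-derivable (Γ ⊢ c)

by-rga : ∀ {ps j} → ps ⟹ᴿ j → All OGA-derivable ps → OGA-derivable j
by-rga r = by (rga r)

-- Index 0 of `p` marks the hole. Its temporary name must be fresh for `ƛ p` alone, as `↦-[]` allows
-- it to occur in the term put in.
≐-replace : ∀ {Γ a b} p → Γ ⊩ a ≐ b → Γ ⊩ p [ a ] → Γ ⊩ p [ b ]
≐-replace {Γ} p a≐b pa with fresh ((ƛ p) ∷ [])
... | i , i∉ = transport (Γ ⊩_) (↦-[] p (i∉ ∘ here))
  (by-rga (≐-subst i (p [ var i ]))
    (a≐b ∷ transport (Γ ⊩_) (sym (↦-[] p (i∉ ∘ here))) pa ∷ []))

-- The step is demanded for every `i` because the fresh variable is chosen only inside the proof.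
induction : ∀ {Γ a} p → Γ ⊩ p [ 𝟎 ] →
            (∀ i → var i 𝖭 ∷ p [ var i ] ∷ Γ ⊩ p [ 𝐒 (var i) ]) →
            Γ ⊩ a 𝖭 → Γ ⊩ p [ a ]
induction {Γ} p p0 pS a𝖭 with fresh ((ƛ p) ∷ Γ)
... | i , i∉ = transport (Γ ⊩_) (↦-[] p (i∉ ∘ here))
  (by-rga (ind i (p [ var i ]) (i∉ ∘ there))
    ( transport (Γ ⊩_) (sym (↦-[] p (i∉ ∘ here))) p0
    ∷ transport (var i 𝖭 ∷ p [ var i ] ∷ Γ ⊩_) (sym (↦-[] p (i∉ ∘ here))) (pS i)
    ∷ a𝖭 ∷ []))

≐-trans : ∀ {Γ a b c} → Γ ⊩ a ≐ b → Γ ⊩ b ≐ c → Γ ⊩ a ≐ c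
≐-trans {Γ} {a} {b} {c} a≐b b≐c =
  transport (Γ ⊩_) (cong (_≐ c) (↑-[] a c))
    (≐-replace (↑ a ≐ var 0) b≐c
      (transport (Γ ⊩_) (cong (_≐ b) (sym (↑-[] a b))) a≐b))

-- `a 𝖭` is `a ≐ a`: go from `a` to `b` and back.
≐⇒𝖭ˡ : ∀ {Γ a b} → Γ ⊩ a ≐ b → Γ ⊩ a 𝖭
≐⇒𝖭ˡ a≐b = ≐-trans a≐b (by-rga ≐-sym (a≐b ∷ []))

∨-elim : ∀ {Γ a b c} → Γ ⊩ a ∨ b → a ∷ Γ ⊩ c → b ∷ Γ ⊩ c → Γ ⊩ c
∨-elim d e f = by-rga ∨-E (d ∷ e ∷ f ∷ [])

assume : ∀ {Γ c} → c ∷ Γ ⊩ c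
assume = by-rga hyp []

weak : ∀ {Γ a c} → Γ ⊩ c → a ∷ Γ ⊩ c
weak d = by-rga weaken (d ∷ [])

𝖭-expand : ∀ {Γ c c′} → c ▷ c′ → Γ ⊩ c′ 𝖭 → Γ ⊩ c 𝖭
𝖭-expand r d = ≐⇒𝖭ˡ (by-rga (▷-≐ r) (d ∷ []))

𝖭-expand* : ∀ {Γ c c′} → Star _▷_ c c′ → Γ ⊩ c′ 𝖭 → Γ ⊩ c 𝖭
𝖭-expand* ε        d = d
𝖭-expand* (r ◅ rs) d = 𝖭-expand r (𝖭-expand* rs d)

-- A boolean equals num 1 or num 0, so it satisfies 𝖭 and ▷-≐ applies to it.
𝖡-expand : ∀ {Γ c c′} → c ▷ c′ → Γ ⊩ c′ 𝖡 → Γ ⊩ c 𝖡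
𝖡-expand r d = ∨-elim d
  (by-rga ∨-I₁ (by-rga (▷-exp r) (assume ∷ []) ∷ []))
  (by-rga ∨-I₂ (by-rga false-E (≐-trans (by-rga (▷-≐ r) (≐⇒𝖭ˡ c′≐0 ∷ [])) c′≐0 ∷ []) ∷ []))
  where c′≐0 = by-rga false-I (assume ∷ [])

∼-𝖡 : ∀ {Γ a} → Γ ⊩ a 𝖡 → Γ ⊩ (∼ a) 𝖡
∼-𝖡 d = ∨-elim d
  (by-rga ∨-I₂ (by-rga ∼∼-I (assume ∷ []) ∷ []))
  (by-rga ∨-I₁ (assume ∷ []))

-- Two redexes separate the hypothesis from the goal left by `𝓐-I`: the outer one is the whole
-- formula, so `▷-exp` suffices; the inner one sits inside `𝖡` and takes `𝖡-expand`.
𝓐-𝖡 : ∀ {Γ} b → var 0 𝖭 ∷ map ↑ Γ ⊩ b 𝖡 → Γ ⊩ (𝓐 · (ƛ b)) 𝖡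
𝓐-𝖡 b d = by ATI
  (by-rga 𝓐-I
    (by-rga (▷-exp (↑ƛ-▷ ((↑ (ƛ b) · var 0) 𝖡))) (𝖡-expand (↑ƛ-▷ b) d ∷ []) ∷ []) ∷ [])

-- The shift stays because for variable `n` the term `↑ (num n)` does not compute to `num n`.
↑num-𝖭 : ∀ {Γ} n → Γ ⊩ (↑ (num n)) 𝖭
↑num-𝖭 zero    = by-rga 𝟎-𝖭 []
↑num-𝖭 (suc n) = by-rga 𝐒-𝖭 (↑num-𝖭 n ∷ [])

recursor-𝖭 : ∀ {Γ} g h t → Γ ⊩ g 𝖭 →
  (∀ i → var i 𝖭 ∷ (𝓡 · g · h · var i) 𝖭 ∷ Γ ⊩ (h · var i · (𝓡 · g · h · var i)) 𝖭) →
  Γ ⊩ t 𝖭 → Γ ⊩ (𝓡 · g · h · t) 𝖭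
recursor-𝖭 {Γ} g h t g𝖭 h𝖭 t𝖭 = transport (Γ ⊩_) (instance-of t)
  (induction p
    (transport (Γ ⊩_) (sym (instance-of 𝟎)) (𝖭-expand rec0 g𝖭))
    (λ i → cong-⊩ (sym (instance-of (var i))) (sym (instance-of (𝐒 (var i))))
      -- `recS` fires only at numerals; at a variable the equation comes from `𝓡-𝐒`, and its left
      -- side is the term wanted.
      (≐⇒𝖭ˡ (by-rga 𝓡-𝐒 (assume ∷ h𝖭 i ∷ []))))
    t𝖭)
  where
  p : Term
  p = (↑ (𝓡 · g · h) · var 0) 𝖭

  instance-of : ∀ a → p [ a ] ≡ (𝓡 · g · h · a) 𝖭
  instance-of a = cong (λ q → (q · a) 𝖭) (↑-[] (𝓡 · g · h) a)

  cong-⊩ : ∀ {a c c′ d d′} → c ≡ c′ → d ≡ d′ → a ∷ c ∷ Γ ⊩ d → a ∷ c′ ∷ Γ ⊩ d′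
  cong-⊩ refl refl e = e

-- Evaluation of compiled functions

-- Arguments are pushed first to last, so the last one gets index 0 and `σ` starts at index `n`, in
-- agreement with `args`.
env : ∀ {n} → Vec Term n → (ℕ → Term) → ℕ → Term
env []       σ = σ
env (t ∷ ts) σ = env ts (t • σ)

apps-▷ : ∀ {n t u} (ts : Vec Term n) → t ▷ u → apps t ts ▷ apps u ts
apps-▷ []       r = r
apps-▷ (_ ∷ ts) r = apps-▷ ts (appˡ r)

lams-▷* : ∀ {n} σ b (ts : Vec Term n) →
          Star _▷_ (apps (subst σ (lams n b)) ts) (subst (env ts σ) b)
lams-▷*             σ b []       = ε
lams-▷* {n = suc n} σ b (t ∷ ts) =
  apps-▷ ts (transport ((ƛ subst (liftSub σ) (lams n b)) · t ▷_) (lift-[] σ t (lams n b)) β)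
  ◅ lams-▷* (t • σ) b ts

lams-𝖭 : ∀ {Γ n} σ b (ts : Vec Term n) →
         Γ ⊩ (subst (env ts σ) b) 𝖭 → Γ ⊩ (apps (subst σ (lams n b)) ts) 𝖭
lams-𝖭 σ b ts = 𝖭-expand* (lams-▷* σ b ts)

subst-apps : ∀ {n} σ t (us : Vec Term n) →
             subst σ (apps t us) ≡ apps (subst σ t) (Vec.map (subst σ) us)
subst-apps σ t []       = refl
subst-apps σ t (u ∷ us) = subst-apps σ (t · u) us

env-+ : ∀ {n} (ts : Vec Term n) σ k → env ts σ (n + k) ≡ σ k
env-+             []       σ k = refl
env-+ {n = suc n} (t ∷ ts) σ k =
  trans (cong (env ts (t • σ)) (sym (+-suc n k))) (env-+ ts (t • σ) (suc k))

-- `τ` is `env ts σ` behind `d` further entries: `d` is 0 for a plain body and 2 inside the step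
-- term of a recursor.
env-args : ∀ {n} (ts : Vec Term n) σ d τ → (∀ i → τ (i + d) ≡ env ts σ i) →
           Vec.map (subst τ) (args n d) ≡ ts
env-args []       σ d τ e = refl
env-args {n = suc n} (t ∷ ts) σ d τ e = cong₂ _∷_
  (trans (e n) (trans (cong (env ts (t • σ)) (sym (+-identityʳ n))) (env-+ ts (t • σ) 0)))
  (env-args ts (t • σ) d τ e)

env-args₀ : ∀ {n} (ts : Vec Term n) σ → Vec.map (subst (env ts σ)) (args n 0) ≡ ts
env-args₀ ts σ = env-args ts σ 0 (env ts σ) (λ i → cong (env ts σ) (+-identityʳ i))

infix 3 _⊩*_

_⊩*_ : ∀ {n} → Context → Vec Term n → Set
Γ ⊩* ts = VecAll.All (λ t → Γ ⊩ t 𝖭) ts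

mutual
  -- The arbitrary `σ` absorbs the substitutions that earlier β-steps leave on `cmp f`, so
  -- closedness of compiled terms never has to be proved.
  cmp-𝖭 : ∀ {n Γ} (f : PR n) σ ts → Γ ⊩* ts → Γ ⊩ (apps (subst σ (cmp f)) ts) 𝖭
  cmp-𝖭 zer σ ts ts𝖭 = lams-𝖭 σ 𝟎 ts (by-rga 𝟎-𝖭 [])
  cmp-𝖭 succ σ (t ∷ []) (t𝖭 ∷ []) = 𝖭-expand β (by-rga 𝐒-𝖭 (t𝖭 ∷ []))
  cmp-𝖭 {n} {Γ} (proj i) σ ts ts𝖭 = lams-𝖭 σ (Vec.lookup (args n 0) i) ts
    (transport (λ t → Γ ⊩ t 𝖭)
      (trans (cong (λ us → Vec.lookup us i) (sym (env-args₀ ts σ)))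
             (lookup-map i (subst (env ts σ)) (args n 0)))
      (lookup⁺ ts𝖭 i))
  cmp-𝖭 {n} {Γ} (comp g hs) σ ts ts𝖭 = lams-𝖭 σ (apps (cmp g) (cmp* hs (args n 0))) ts
    (transport (λ t → Γ ⊩ t 𝖭) (sym (subst-apps (env ts σ) (cmp g) (cmp* hs (args n 0))))
      (cmp-𝖭 g (env ts σ) _
        (cmp*-𝖭 hs (env ts σ) (args n 0)
          (transport (Γ ⊩*_) (sym (env-args₀ ts σ)) ts𝖭))))
  cmp-𝖭 {suc n} {Γ} (prec g h) σ (t ∷ ts) (t𝖭 ∷ ts𝖭) =
    lams-𝖭 σ (𝓡 · apps (cmp g) (args n 0) · lams 2 body · var n) (t ∷ ts)
      (recursor-𝖭 _ _ _ g𝖭 (λ i → lams-𝖭 τ body (var i ∷ _ ∷ [])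
          (body-𝖭 assume (weak assume) (VecAll.map (weak ∘ weak) ts𝖭)))
        -- The recursion argument is pushed before `ts`, hence is found at index `n`.
        (transport (λ u → Γ ⊩ u 𝖭)
          (trans (sym (env-+ ts (t • σ) 0)) (cong τ (+-identityʳ n))) t𝖭))
    where
    τ = env ts (t • σ)
    body = apps (cmp h · var 1 · var 0) (args n 2)

    g𝖭 : Γ ⊩ (subst τ (apps (cmp g) (args n 0))) 𝖭
    g𝖭 = transport (λ u → Γ ⊩ u 𝖭) (sym (subst-apps τ (cmp g) (args n 0)))
      (cmp-𝖭 g τ _ (transport (Γ ⊩*_) (sym (env-args₀ ts (t • σ))) ts𝖭))

    -- The counter `m` is pushed first and the previous value `r` second, so they are `var 1` and
    -- `var 0` of `body`.
    body-𝖭 : ∀ {Δ m r} → Δ ⊩ m 𝖭 → Δ ⊩ r 𝖭 → Δ ⊩* ts → Δ ⊩ (subst (r • m • τ) body) 𝖭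
    body-𝖭 {Δ} {m} {r} m𝖭 r𝖭 us𝖭 =
      transport (λ u → Δ ⊩ u 𝖭) (sym (subst-apps τ′ (cmp h · var 1 · var 0) (args n 2)))
        (cmp-𝖭 h τ′ (m ∷ r ∷ _) (m𝖭 ∷ r𝖭 ∷ transport (Δ ⊩*_)
          (sym (env-args ts (t • σ) 2 τ′ (λ i → cong τ′ (+-comm i 2)))) us𝖭))
      where τ′ = r • m • τ

  cmp*-𝖭 : ∀ {m n Γ} (hs : Vec (PR n) m) σ us → Γ ⊩* Vec.map (subst σ) us →
           Γ ⊩* Vec.map (subst σ) (cmp* hs us)
  cmp*-𝖭 [] σ us us𝖭 = []
  cmp*-𝖭 {Γ = Γ} (h ∷ hs) σ us us𝖭 =
    transport (λ t → Γ ⊩ t 𝖭) (sym (subst-apps σ (cmp h) us)) (cmp-𝖭 h σ _ us𝖭)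
    ∷ cmp*-𝖭 hs σ us us𝖭

lemma4p1 : (f : StepFunction) (n : ℕ) → OGA-derivable ([] ⊢ (rrep f · num n) 𝖡)
lemma4p1 f n = 𝖡-expand β (∼-𝖡 (𝓐-𝖡 _ (by-rga ≐-𝖡
  -- The outer β-step acts under the quantifier's binder, hence the lifted substitution and the
  -- shifted numeral; `assume` is the hypothesis `var 0 𝖭`.
  (cmp-𝖭 f (liftSub (β-sub (num n))) (↑ (num n) ∷ var 0 ∷ []) (↑num-𝖭 n ∷ assume ∷ [])
  ∷ by-rga 𝟎-𝖭 [] ∷ []))))
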